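{- For every integer $n\ge 1$, $$\mathrm{pf}_n(213,312)=\sum_{k=0}^{n-1}\sum_{i=0}^{k}\binom{n-1}{i}\cdot\frac{(k+1)\binom{2n-2-k}{n-1-k}}{n}.$$
   Context: A Dyck path of semilength $n$ is a lattice path from $(0,0)$ to $(n,n)$ consisting of $n$ north steps $N=(0,1)$ and $n$ east steps $E=(1,0)$ that never goes below the line $y=x$. A parking function of size $n$ is a Dyck path of semilength $n$ whose $n$ north steps are labeled bijectively by $\{1,\dots,n\}$ so that whenever two north steps are consecutive in the path (one immediately following the other), the label of the later one is larger. For a parking function $p$ of size $n$, $\phi(p)$ is the permutation of $\{1,\dots,n\}$ (in one-line notation) obtained by reading the labels of the north steps in the order they occur along the path. A permutation $\pi$ of $\{1,\dots,n\}$ contains a permutation $\rho$ of $\{1,\dots,m\}$ if there are indices $1\le i_1<\cdots<i_m\le n$ such that $\pi_{i_a}\le\pi_{i_b}$ if and only if $\rho_a\le\rho_b$; otherwise $\pi$ avoids $\rho$. For permutations $\rho_1,\dots,\rho_r$, $\mathrm{pf}_n(\rho_1,\dots,\rho_r)$ denotes the number of parking functions $p$ of size $n$ such that $\phi(p)$ avoids each of $\rho_1,\dots,\rho_r$. -}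

module Defs where

open import Data.Fin.Base as Fin using (Fin; toℕ)
import Data.Fin.Properties as Fin
open import Data.List.Base
  using (List; []; _∷_; [_]; length; lookup; map; filter; inits; allFin; cartesianProductWith)
open import Data.List.Membership.Propositional using (_∈_)
open import Data.List.Membership.Propositional.Properties
  using (∈-allFin; ∈-map⁺; ∈-map⁻; ∈-cartesianProductWith⁺)
open import Data.List.Membership.DecPropositional using () renaming (_∈?_ to memberOf)
open import Data.List.Properties using (∷-injective)
open import Data.List.Relation.Unary.All as All using (All; []; _∷_)
open import Data.List.Relation.Unary.Any using (here; there)
open import Data.List.Relation.Unary.Linked using (Linked; linked?)
open import Data.List.Relation.Unary.Unique.Propositional using (Unique; []; _∷_)
import Data.List.Relation.Unary.Unique.Propositional.Properties as Unique
open import Data.List.Relation.Unary.Unique.DecPropositional using (unique?)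
open import Data.Nat.Base as ℕ using (ℕ; zero; suc; _+_; _≤_)
import Data.Nat.Properties as ℕ
open import Data.Product.Base using (∃; _×_; _,_; uncurry)
open import Data.Unit.Base using (⊤; tt)
open import Data.Vec.Base as Vec using (Vec; []; _∷_)
open import Function.Base using (_∘_)
open import Function.Bundles using (_⇔_; mk⇔; module Equivalence)
open import Relation.Binary.Definitions using () renaming (Decidable to Decidable₂)
open import Relation.Binary.PropositionalEquality using (_≡_; refl; cong)
open import Relation.Nullary.Decidable using (Dec; yes; map′; ¬?; _×-dec_; _→-dec_)
open import Relation.Nullary.Negation using (¬_)
open import Relation.Unary using (Decidable)

private
  variable
    n : ℕ

-- Labelled lattice paths.  The label i : Fin n stands for the number
-- 1 + toℕ i of {1, …, n}.

data Step (n : ℕ) : Set where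
  N : Fin n → Step n
  E : Step n

Path : ℕ → Set
Path n = List (Step n)

labels : Path n → List (Fin n)
labels []        = []
labels (N i ∷ w) = i ∷ labels w
labels (E   ∷ w) = labels w

#N #E : Path n → ℕ
#N w = length (labels w)

#E []        = 0
#E (N _ ∷ w) = #E w
#E (E   ∷ w) = suc (#E w)

-- After the steps u the path is at the point (#E u , #N u).

NeverBelowDiagonal : Path n → Set
NeverBelowDiagonal w = All (λ u → #E u ≤ #N u) (inits w)

IncreasingIfNorths : Step n → Step n → Set
IncreasingIfNorths (N i) (N j) = i Fin.< j
IncreasingIfNorths (N _) E     = ⊤
IncreasingIfNorths E     _     = ⊤

record IsParkingFunction (w : Path n) : Set where
  field
    norths           : #N w ≡ n
    easts            : #E w ≡ n
    neverBelow       : NeverBelowDiagonal w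
    labelsDistinct   : Unique (labels w)
    labelsExhaustive : ∀ i → i ∈ labels w
    labelsIncrease   : Linked IncreasingIfNorths w

φ : Path n → List ℕ
φ w = map (suc ∘ toℕ) (labels w)

-- Pattern containment, for permutations in one-line notation.

StrictlyIncreasing : ∀ {m n} → Vec (Fin n) m → Set
StrictlyIncreasing ι = ∀ a b → a Fin.< b → Vec.lookup ι a Fin.< Vec.lookup ι b

OrderIsomorphicAt : (π ρ : List ℕ) → Vec (Fin (length π)) (length ρ) → Set
OrderIsomorphicAt π ρ ι = ∀ a b →
  lookup π (Vec.lookup ι a) ≤ lookup π (Vec.lookup ι b) ⇔ lookup ρ a ≤ lookup ρ b

_Contains_ : List ℕ → List ℕ → Set
π Contains ρ = ∃ λ ι → StrictlyIncreasing ι × OrderIsomorphicAt π ρ ι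

_Avoids_ : List ℕ → List ℕ → Set
π Avoids ρ = ¬ (π Contains ρ)

AvoidingParkingFunction : List (List ℕ) → Path n → Set
AvoidingParkingFunction ρs w = IsParkingFunction w × All (φ w Avoids_) ρs

-- Decidability

increasingIfNorths? : Decidable₂ (IncreasingIfNorths {n})
increasingIfNorths? (N i) (N j) = i Fin.<? j
increasingIfNorths? (N _) E     = yes tt
increasingIfNorths? E     _     = yes tt

isParkingFunction? : Decidable (IsParkingFunction {n})
isParkingFunction? {n} w = map′
  (λ (p , q , r , s , t , u) → record
    { norths = p ; easts = q ; neverBelow = r
    ; labelsDistinct = s ; labelsExhaustive = t ; labelsIncrease = u })
  (λ p → let open IsParkingFunction p in
    norths , easts , neverBelow , labelsDistinct , labelsExhaustive , labelsIncrease)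
  (#N w ℕ.≟ n
    ×-dec #E w ℕ.≟ n
    ×-dec All.all? (λ u → #E u ℕ.≤? #N u) (inits w)
    ×-dec unique? Fin._≟_ (labels w)
    ×-dec Fin.all? (λ i → memberOf Fin._≟_ i (labels w))
    ×-dec linked? increasingIfNorths? w)

anyVec? : ∀ {m n} {P : Vec (Fin n) m → Set} → Decidable P → Dec (∃ P)
anyVec? {zero}  P? = map′ ([] ,_) (λ { ([] , p) → p }) (P? [])
anyVec? {suc m} P? = map′
  (λ (x , v , p) → x ∷ v , p)
  (λ { (x ∷ v , p) → x , v , p })
  (Fin.any? (λ x → anyVec? (λ v → P? (x ∷ v))))

_⇔-dec_ : ∀ {A B : Set} → Dec A → Dec B → Dec (A ⇔ B)
a? ⇔-dec b? = map′
  (uncurry mk⇔)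
  (λ e → Equivalence.to e , Equivalence.from e)
  ((a? →-dec b?) ×-dec (b? →-dec a?))

_contains?_ : Decidable₂ _Contains_
π contains? ρ = anyVec? λ ι →
  (Fin.all? λ a → Fin.all? λ b →
    (a Fin.<? b) →-dec (Vec.lookup ι a Fin.<? Vec.lookup ι b))
  ×-dec
  (Fin.all? λ a → Fin.all? λ b →
    (lookup π (Vec.lookup ι a) ℕ.≤? lookup π (Vec.lookup ι b))
    ⇔-dec (lookup ρ a ℕ.≤? lookup ρ b))

avoidingParkingFunction? : ∀ ρs → Decidable (AvoidingParkingFunction {n} ρs)
avoidingParkingFunction? ρs w =
  isParkingFunction? w ×-dec All.all? (λ ρ → ¬? (φ w contains? ρ)) ρs

-- Counting

steps : ∀ n → List (Step n)
steps n = E ∷ map N (allFin n)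

paths : ∀ n → ℕ → List (Path n)
paths n zero    = [ [] ]
paths n (suc l) = cartesianProductWith _∷_ (steps n) (paths n l)

pf : ℕ → List (List ℕ) → ℕ
pf n ρs = length (filter (avoidingParkingFunction? ρs) (paths n (n + n)))

-- paths n l lists every path of l steps exactly once, and every parking
-- function of size n has n + n steps, so pf misses and repeats nothing.

∈-steps : (s : Step n) → s ∈ steps n
∈-steps (N i) = there (∈-map⁺ N (∈-allFin i))
∈-steps E     = here refl

steps-unique : ∀ n → Unique (steps n)
steps-unique n =
  All.tabulate (λ { s∈ refl → E∉ (∈-map⁻ N s∈) })
  ∷ Unique.map⁺ (λ { refl → refl }) (Unique.allFin⁺ n)
  where
  E∉ : ¬ (∃ λ i → i ∈ allFin n × E ≡ N i)
  E∉ (_ , _ , ())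

∈-paths : (w : Path n) → w ∈ paths n (length w)
∈-paths []      = here refl
∈-paths (s ∷ w) = ∈-cartesianProductWith⁺ _∷_ (∈-steps s) (∈-paths w)

paths-unique : ∀ n l → Unique (paths n l)
paths-unique n zero    = [] ∷ []
paths-unique n (suc l) =
  Unique.cartesianProductWith⁺ _∷_ ∷-injective (steps-unique n) (paths-unique n l)

length-#N+#E : (w : Path n) → length w ≡ #N w + #E w
length-#N+#E []        = refl
length-#N+#E (N _ ∷ w) = cong suc (length-#N+#E w)
length-#N+#E (E   ∷ w) rewrite ℕ.+-suc (#N w) (#E w) = cong suc (length-#N+#E w)

{-# OPTIONS --safe #-}

-- A permutation avoids 213 and 312 exactly when it rises to its maximum and
-- then falls, so it arises by inserting the labels from the greatest to the
-- least, each at the front or at the back; C(n-1, d) of them fall d times.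
-- How many Dyck paths a given label word admits depends only on d: after each
-- fall the path must take an east step before the next north step.  By
-- reflection these paths number C(n+a, n) - C(n+a, n+1), where a = n-1-d, and
-- n times this difference is the sum over k from d to n-1 of
-- (k+1) C(2n-2-k, n-1-k).  Exchanging the sums over d and k gives the formula.
module Submission where

open import Defs
import Algebra.Properties.Semiring.Sum as SemiringSum
open import Data.Empty using (⊥)
open import Data.Fin.Base as Fin using (Fin; toℕ)
open import Data.Fin.Patterns using (0F; 1F; 2F)
import Data.Fin.Properties as Fin
open import Data.List.Base
  using (List; []; _∷_; _++_; _∷ʳ_; length; lookup; map; filter; concatMap; inits; tabulate; allFin)
open import Data.List.Membership.Propositional using (_∈_)
open import Data.List.Membership.Propositional.Properties
  using ( ∈-++⁺ˡ; ∈-++⁺ʳ; ∈-++⁻; ∈-map⁺; ∈-map⁻; ∈-∃++; ∈-lookup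
        ; ∈-concat⁺′; ∈-concat⁻′; ∈-filter⁺; ∈-filter⁻; ∈-allFin)
open import Data.List.Membership.Propositional.Properties.WithK using (unique∧set⇒bag)
open import Data.List.Properties
  using (length-map; length-++; length-tabulate; map-++; map-∘; ∷-injectiveʳ; ∷ʳ-injectiveˡ)
open import Data.List.Relation.Binary.BagAndSetEquality using (∼bag⇒↭)
open import Data.List.Relation.Binary.Disjoint.Propositional using (Disjoint)
open import Data.List.Relation.Binary.Permutation.Propositional
  using (_↭_; ↭-refl; prep; ↭-trans; ↭-sym; ↭⇒↭ₛ)
open import Data.List.Relation.Binary.Permutation.Propositional.Properties
  using (∷↭∷ʳ; ∈-resp-↭; All-resp-↭; ↭-length; ↭-singleton-inv; drop-∷; shift)
open import Data.List.Relation.Binary.Permutation.Setoid.Properties using (Unique-resp-↭)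
open import Data.List.Relation.Unary.All as All using (All; []; _∷_)
import Data.List.Relation.Unary.All.Properties as All
open import Data.List.Relation.Unary.AllPairs as AllPairs using (AllPairs; []; _∷_)
import Data.List.Relation.Unary.AllPairs.Properties as AllPairs
open import Data.List.Relation.Unary.Any using (here)
open import Data.List.Relation.Unary.Linked as Linked using (Linked; []; [-]; _∷_)
open import Data.List.Relation.Unary.Unique.Propositional using (Unique)
import Data.List.Relation.Unary.Unique.Propositional.Properties as Unique
open import Data.Nat.Base using (ℕ; zero; suc; _+_; _*_; _∸_; _≤_; _<_; s≤s; z≤n; NonZero)
open import Data.Nat.Combinatorics
  using (_C_; nCn≡1; nC1≡n; nCk≡nC[n∸k]; nCk+nC[k+1]≡[n+1]C[k+1]; k>n⇒nCk≡0)
open import Data.Nat.ListAction using (sum)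
open import Data.Nat.ListAction.Properties using (sum-++)
import Data.Nat.Properties as ℕ
open import Data.Nat.Tactic.RingSolver using (solve-∀)
open import Data.Product.Base using (_,_; _×_; proj₂)
open import Data.Sum.Base using (inj₁; inj₂; [_,_]′)
open import Data.Unit.Base using (tt)
open import Data.Vec.Base using ([]; _∷_)
open import Function.Base using (_∘_; id)
open import Function.Bundles using (_⇔_; mk⇔; module Equivalence)
open import Level using (Level; _⊔_)
open import Relation.Binary.Core using (Rel)
open import Relation.Binary.Definitions using (tri<; tri≈; tri>)
open import Relation.Binary.PropositionalEquality
open import Relation.Nullary using (¬_; yes; no; contradiction)
open import Relation.Unary using (Decidable)

module Sum = SemiringSum ℕ.+-*-semiring

private
  variable
    ℓ ℓ₁ ℓ₂ : Level
    A B : Set ℓ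
    n h : ℕ
    s : Step n
    x y : Fin n
    l σ : List (Fin n)
    w : Path n

-- Completions of a path with prescribed labels

-- Run h s l w: after a step s that ends at height h above the diagonal, the
-- steps w read the labels l and end on the diagonal.
data Run {n} : ℕ → Step n → List (Fin n) → Path n → Set where
  done  : Run 0 s [] []
  east  : Run h E l w → Run (suc h) s l (E ∷ w)
  north : IncreasingIfNorths s (N x) → Run (suc h) (N x) l w → Run h s (x ∷ l) (N x ∷ w)

-- The recursion terminates because a north step consumes a label, while an east step keeps the
-- labels and lowers `h`. The last step is carried along only to test the label of a north step that
-- directly follows it.
completions : ℕ → Step n → List (Fin n) → List (Path n)
northFirst : ℕ → Step n → List (Fin n) → List (Path n)
eastFirst : ℕ → List (Fin n) → List (Path n)

completions zero s []    = [] ∷ []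
completions h    s l     = northFirst h s l ++ eastFirst h l

northFirst h s [] = []
northFirst h s (x ∷ l) with increasingIfNorths? s (N x)
... | yes _ = map (N x ∷_) (completions (suc h) (N x) l)
... | no  _ = []

eastFirst zero    l = []
eastFirst (suc h) l = map (E ∷_) (completions h E l)

∈-completions⁻ : ∀ h (s : Step n) l → w ∈ completions h s l → Run h s l w
∈-northFirst⁻ : ∀ h (s : Step n) l → w ∈ northFirst h s l → Run h s l w
∈-eastFirst⁻ : ∀ h (s : Step n) l → w ∈ eastFirst h l → Run h s l w

∈-completions⁻ zero    s []      (here refl) = done
∈-completions⁻ zero    s (x ∷ l) w∈ =
  [ ∈-northFirst⁻ zero s (x ∷ l) , ∈-eastFirst⁻ zero s (x ∷ l) ]′ (∈-++⁻ (northFirst zero s (x ∷ l)) w∈)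
∈-completions⁻ (suc h) s l w∈ =
  [ ∈-northFirst⁻ (suc h) s l , ∈-eastFirst⁻ (suc h) s l ]′ (∈-++⁻ (northFirst (suc h) s l) w∈)

∈-northFirst⁻ h s (x ∷ l) w∈ with increasingIfNorths? s (N x)
... | yes p with _ , v∈ , refl ← ∈-map⁻ (N x ∷_) w∈ = north p (∈-completions⁻ (suc h) (N x) l v∈)

∈-eastFirst⁻ (suc h) s l w∈ with _ , v∈ , refl ← ∈-map⁻ (E ∷_) w∈ = east (∈-completions⁻ h E l v∈)

∈-completions⁺ : Run h s l w → w ∈ completions h s l
∈-northFirst⁺ : IncreasingIfNorths s (N x) → Run (suc h) (N x) l w →
                N x ∷ w ∈ northFirst h s (x ∷ l)

∈-completions⁺ done = here refl
∈-completions⁺ {s = s} (east {h = h} {l = l} r) =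
  ∈-++⁺ʳ (northFirst (suc h) s l) (∈-map⁺ (E ∷_) (∈-completions⁺ r))
∈-completions⁺ {h = zero}  (north p r) = ∈-++⁺ˡ (∈-northFirst⁺ p r)
∈-completions⁺ {h = suc h} (north p r) = ∈-++⁺ˡ (∈-northFirst⁺ p r)

∈-northFirst⁺ {s = s} {x = x} p r with increasingIfNorths? s (N x)
... | yes _ = ∈-map⁺ (N x ∷_) (∈-completions⁺ r)
... | no ¬p = contradiction p ¬p

northFirst#eastFirst : ∀ h h′ (s : Step n) l l′ → Disjoint (northFirst h s l) (eastFirst h′ l′)
northFirst#eastFirst h (suc h′) s (x ∷ l) l′ (∈n , ∈e)
  with increasingIfNorths? s (N x)
... | yes _ with _ , _ , refl ← ∈-map⁻ (N x ∷_) ∈n with _ , _ , () ← ∈-map⁻ (E ∷_) ∈e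

completions-unique : ∀ h (s : Step n) l → Unique (completions h s l)
northFirst-unique : ∀ h (s : Step n) l → Unique (northFirst h s l)
eastFirst-unique : ∀ h (l : List (Fin n)) → Unique (eastFirst h l)

completions-unique zero    s []      = [] ∷ []
completions-unique zero    s (x ∷ l) =
  Unique.++⁺ (northFirst-unique 0 s (x ∷ l)) [] (northFirst#eastFirst 0 0 s (x ∷ l) (x ∷ l))
completions-unique (suc h) s l       =
  Unique.++⁺ (northFirst-unique (suc h) s l) (eastFirst-unique (suc h) l) (northFirst#eastFirst (suc h) (suc h) s l l)

northFirst-unique h s [] = []
northFirst-unique h s (x ∷ l) with increasingIfNorths? s (N x)
... | yes _ = Unique.map⁺ ∷-injectiveʳ (completions-unique (suc h) (N x) l)
... | no  _ = []

eastFirst-unique zero    l = []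
eastFirst-unique (suc h) l = Unique.map⁺ ∷-injectiveʳ (completions-unique h E l)

run-labels : Run h s l w → labels w ≡ l
run-labels done        = refl
run-labels (east r)    = run-labels r
run-labels (north _ r) = cong (_ ∷_) (run-labels r)

run-#E : Run h s l w → #E w ≡ h + #N w
run-#E done = refl
run-#E (east r) = cong suc (run-#E r)
run-#E {h = h} (north {w = w} _ r) = trans (run-#E r) (sym (ℕ.+-suc h (#N w)))

run-linked : Run h s l w → Linked IncreasingIfNorths (s ∷ w)
run-linked done = [-]
run-linked {s = N _} (east r) = tt ∷ run-linked r
run-linked {s = E}   (east r) = tt ∷ run-linked r
run-linked (north p r) = p ∷ run-linked r

NeverBelowFrom : ℕ → Path n → Set
NeverBelowFrom h w = All (λ u → #E u ≤ h + #N u) (inits w)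

run-neverBelow : Run h s l w → NeverBelowFrom h w
run-neverBelow done = z≤n ∷ []
run-neverBelow (east r) = z≤n ∷ All.map⁺ (All.map s≤s (run-neverBelow r))
run-neverBelow {h = h} (north {w = w} _ r) =
  z≤n ∷ All.map⁺ (All.map (λ {u} p → ℕ.≤-trans p (ℕ.≤-reflexive (sym (ℕ.+-suc h (#N u)))))
                          (run-neverBelow r))

run : ∀ h (s : Step n) w → #E w ≡ h + #N w → NeverBelowFrom h w →
      Linked IncreasingIfNorths (s ∷ w) → Run h s (labels w) w
run zero    s []        e _ _ = done
run (suc h) s (E ∷ w)   e (_ ∷ b) (_ ∷ i) =
  east (run h E w (ℕ.suc-injective e) (All.map ℕ.≤-pred (All.map⁻ b)) i)
-- The prefix made of this single east step already lies below the diagonal.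
run zero    s (E ∷ w)   e (_ ∷ () ∷ _) i
run h       s (N x ∷ w) e (_ ∷ b) (p ∷ i) =
  north p (run (suc h) (N x) w (trans e (ℕ.+-suc h (#N w)))
    (All.map (λ {u} q → ℕ.≤-trans q (ℕ.≤-reflexive (ℕ.+-suc h (#N u)))) (All.map⁻ b)) i)

-- The number of completions of a unimodal label word.

-- Peak a d l: l rises a times and then falls d times.
data Peak {n} : ℕ → ℕ → List (Fin n) → Set where
  falls : Linked Fin._>_ (x ∷ l) → Peak 0 (length l) (x ∷ l)
  rises : ∀ {a d y} → x Fin.< y → Peak a d (y ∷ l) → Peak (suc a) d (x ∷ y ∷ l)

count : ℕ → Step n → List (Fin n) → ℕ
count h s l = length (completions h s l)

count-northFirst : IncreasingIfNorths s (N x) → length (northFirst h s (x ∷ l)) ≡ count (suc h) (N x) l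
count-northFirst {s = s} {x = x} {h = h} {l = l} p with increasingIfNorths? s (N x)
... | yes _ = length-map (N x ∷_) (completions (suc h) (N x) l)
... | no ¬p = contradiction p ¬p

northFirst-blocked : ∀ h → Linked Fin._>_ (x ∷ l) → northFirst h (N x) l ≡ []
northFirst-blocked h [-] = refl
northFirst-blocked {x = x} h (_∷_ {y = y} x>y _) with x Fin.<? y
... | yes x<y = contradiction x>y (ℕ.<-asym x<y)
... | no  _   = refl

-- The preceding step matters only through the test on an immediate north step. If the test
-- succeeds, `s` is as good as an east step.
count-free : IncreasingIfNorths s (N x) → ∀ h → count h s (x ∷ l) ≡ count h E (x ∷ l)
count-free {s = s} {x = x} {l = l} p h = begin
  count h s (x ∷ l)
    ≡⟨ split s h ⟩
  length (northFirst h s (x ∷ l)) + length (eastFirst h (x ∷ l))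
    ≡⟨ cong (_+ _) (trans (count-northFirst p) (sym (count-northFirst {s = E} {x = x} {h = h} {l = l} tt))) ⟩
  length (northFirst h E (x ∷ l)) + length (eastFirst h (x ∷ l))
    ≡⟨ split E h ⟨
  count h E (x ∷ l) ∎
  where
  open ≡-Reasoning
  split : ∀ s h → count h s (x ∷ l) ≡ length (northFirst h s (x ∷ l)) + length (eastFirst h (x ∷ l))
  split s zero    = length-++ (northFirst 0 s (x ∷ l))
  split s (suc h) = length-++ (northFirst (suc h) s (x ∷ l))

-- After `x` no north step is possible, so the path is forced to go east and lose one unit of
-- height.
count-blocked : ∀ h → Linked Fin._>_ (x ∷ l) → count (suc h) (N x) l ≡ count h E l
count-blocked {l = l} h x>l rewrite northFirst-blocked (suc h) x>l =
  length-map (E ∷_) (completions h E l)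

count-zero : ∀ (x : Fin n) l → count 0 E (x ∷ l) ≡ count 1 (N x) l
count-zero x l = begin
  length (map (N x ∷_) (completions 1 (N x) l) ++ []) ≡⟨ length-++ (map (N x ∷_) (completions 1 (N x) l)) ⟩
  length (map (N x ∷_) (completions 1 (N x) l)) + 0   ≡⟨ ℕ.+-identityʳ _ ⟩
  length (map (N x ∷_) (completions 1 (N x) l))       ≡⟨ length-map _ (completions 1 (N x) l) ⟩
  count 1 (N x) l                                     ∎
  where open ≡-Reasoning

count-suc : ∀ h (x : Fin n) l → count (suc h) E (x ∷ l) ≡ count (suc (suc h)) (N x) l + count h E (x ∷ l)
count-suc h x l = begin
  count (suc h) E (x ∷ l)
    ≡⟨ length-++ (map (N x ∷_) (completions (suc (suc h)) (N x) l)) ⟩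
  length (map (N x ∷_) (completions (suc (suc h)) (N x) l)) + length (map (E ∷_) (completions h E (x ∷ l)))
    ≡⟨ cong₂ _+_ (length-map _ (completions (suc (suc h)) (N x) l)) (length-map _ (completions h E (x ∷ l))) ⟩
  count (suc (suc h)) (N x) l + count h E (x ∷ l) ∎
  where open ≡-Reasoning

-- Each north step is forced to be followed by an east step. Gluing the two leaves `length l` blocks
-- that keep the height and `h` free east steps, and every arrangement of these is admissible. The
-- induction on the first step is Pascal's rule.
count-falls : ∀ h (l : List (Fin n)) → Linked Fin._>_ l → count h E l ≡ (h + length l) C length l
count-falls zero    []      _ = refl
count-falls (suc h) []      _ = trans (length-map _ (completions h E [])) (count-falls h [] [])
count-falls zero (x ∷ l) x>l = begin
  count 0 E (x ∷ l)           ≡⟨ count-zero x l ⟩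
  count 1 (N x) l             ≡⟨ count-blocked 0 x>l ⟩
  count 0 E l                 ≡⟨ count-falls 0 l (Linked.tail x>l) ⟩
  length l C length l         ≡⟨ nCn≡1 (length l) ⟩
  1                           ≡⟨ nCn≡1 (suc (length l)) ⟨
  suc (length l) C suc (length l) ∎
  where open ≡-Reasoning
count-falls (suc h) (x ∷ l) x>l = begin
  count (suc h) E (x ∷ l)
    ≡⟨ count-suc h x l ⟩
  count (suc (suc h)) (N x) l + count h E (x ∷ l)
    ≡⟨ cong₂ _+_ (count-blocked (suc h) x>l) (count-falls h (x ∷ l) x>l) ⟩
  count (suc h) E l + (h + suc d) C suc d
    ≡⟨ cong₂ _+_ (count-falls (suc h) l (Linked.tail x>l)) (cong (_C suc d) (ℕ.+-suc h d)) ⟩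
  suc (h + d) C d + suc (h + d) C suc d
    ≡⟨ nCk+nC[k+1]≡[n+1]C[k+1] (suc (h + d)) d ⟩
  suc (suc (h + d)) C suc d
    ≡⟨ cong (λ m → suc m C suc d) (ℕ.+-suc h d) ⟨
  (suc h + suc d) C suc d ∎
  where
  open ≡-Reasoning
  d = length l

-- The induction step of the reflection argument: `eq₁` is the identity after a north step, `eq₂`
-- the one after an east step, and Pascal's rule merges both the main and the reflected binomials.
pascal-+ : ∀ c₁ c₂ m j k → c₁ + m C suc k ≡ m C j → c₂ + m C k ≡ m C suc j →
           (c₁ + c₂) + suc m C suc k ≡ suc m C suc j
pascal-+ c₁ c₂ m j k eq₁ eq₂ = begin
  (c₁ + c₂) + suc m C suc k           ≡⟨ cong (_ +_) (nCk+nC[k+1]≡[n+1]C[k+1] m k) ⟨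
  (c₁ + c₂) + (m C k + m C suc k)     ≡⟨ rearrange c₁ c₂ (m C k) (m C suc k) ⟩
  (c₁ + m C suc k) + (c₂ + m C k)     ≡⟨ cong₂ _+_ eq₁ eq₂ ⟩
  m C j + m C suc j                   ≡⟨ nCk+nC[k+1]≡[n+1]C[k+1] m j ⟩
  suc m C suc j                       ∎
  where
  open ≡-Reasoning
  rearrange : ∀ a b c d → (a + b) + (c + d) ≡ (a + d) + (b + c)
  rearrange = solve-∀

-- The ballot number given by the reflection principle, with the subtracted
-- binomial coefficient moved to the left-hand side.
count-peak : ∀ {a d} h → Peak a d l →
             count h E l + suc (h + (d + (a + a))) C suc (suc (h + (d + a)))
               ≡ suc (h + (d + (a + a))) C suc (d + a)
count-peak {l = x ∷ l} h (falls x>l) = begin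
  count h E (x ∷ l) + suc (h + (d + 0)) C suc (suc (h + (d + 0)))
    ≡⟨ cong₂ _+_ (count-falls h (x ∷ l) x>l) (k>n⇒nCk≡0 {suc (h + (d + 0))} ℕ.≤-refl) ⟩
  (h + suc d) C suc d + 0
    ≡⟨ ℕ.+-identityʳ _ ⟩
  (h + suc d) C suc d
    ≡⟨ cong (_C suc d) (ℕ.+-suc h d) ⟩
  suc (h + d) C suc d
    ≡⟨ cong (λ d → suc (h + d) C suc d) (ℕ.+-identityʳ d) ⟨
  suc (h + (d + 0)) C suc (d + 0) ∎
  where
  open ≡-Reasoning
  d = length l
count-peak {l = x ∷ y ∷ l} {a = suc a} {d} zero (rises x<y p)
  rewrite ℕ.+-suc a a | ℕ.+-suc d (suc (a + a)) | ℕ.+-suc d (a + a) | ℕ.+-suc d a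
        | count-zero x (y ∷ l) | count-free {l = l} x<y 1 =
  -- At height 0 there is no east step to take, so its count is 0. This agrees with the formula, as
  -- the main and the reflected binomial coincide there: `k` is `suc (suc (d + a))`.
  trans (cong (_+ suc m C suc k) (sym (ℕ.+-identityʳ (count 1 E (y ∷ l)))))
        (pascal-+ (count 1 E (y ∷ l)) 0 m (suc (d + a)) k (count-peak 1 p) refl)
  where
  m = suc (suc (d + (a + a)))
  k = suc (suc (d + a))
count-peak {l = x ∷ y ∷ l} {a = suc a} {d} (suc h) q@(rises x<y p)
  -- The case of an east first step leaves the word unchanged. Its identity is bound before the
  -- rewriting so that it is normalised together with the goal.
  with c₂ ← count-peak h q
  rewrite ℕ.+-suc a a | ℕ.+-suc d (suc (a + a)) | ℕ.+-suc d (a + a) | ℕ.+-suc d a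
        | ℕ.+-suc h (suc (d + (a + a))) | ℕ.+-suc h (d + (a + a)) | ℕ.+-suc h (d + a)
        | count-suc h x (y ∷ l) | count-free {l = l} x<y (suc (suc h)) =
  pascal-+ (count (suc (suc h)) E (y ∷ l)) (count h E (x ∷ y ∷ l))
    (suc (suc (suc (h + (d + (a + a)))))) (suc (d + a)) (suc (suc (suc (h + (d + a)))))
    (count-peak (suc (suc h)) p) c₂

length-peak : ∀ {a d} → Peak a d l → length l ≡ suc (d + a)
length-peak {l = _ ∷ l} (falls _)       = cong suc (sym (ℕ.+-identityʳ (length l)))
length-peak {a = suc a} {d} (rises _ p) = cong suc (trans (length-peak p) (sym (ℕ.+-suc d a)))

-- Valleys and unimodal lists

module _ {A : Set ℓ₁} (_⊏_ : Rel A ℓ₂) where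

  NoDip : A → List A → Set (ℓ₁ ⊔ ℓ₂)
  NoDip a = AllPairs (λ b c → b ⊏ a → ¬ (b ⊏ c))

  -- A valley is what 213 and 312 have in common: the least entry in the middle, the outer two in
  -- either order. The relation is a parameter because valleys occur both among labels in `Fin n`
  -- and among numbers.
  data NoValley : List A → Set (ℓ₁ ⊔ ℓ₂) where
    []  : NoValley []
    _∷_ : ∀ {x xs} → NoDip x xs → NoValley xs → NoValley (x ∷ xs)

module _ {_⊏_ : Rel A ℓ₁} {_⊏′_ : Rel B ℓ₂} {f : A → B}
         (mono : ∀ {x y} → x ⊏ y → f x ⊏′ f y) (reflects : ∀ {x y} → f x ⊏′ f y → x ⊏ y) where

  noValley-map⁺ : ∀ {xs} → NoValley _⊏_ xs → NoValley _⊏′_ (map f xs)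
  noValley-map⁺ [] = []
  noValley-map⁺ (p ∷ ps) =
    AllPairs.map⁺ (AllPairs.map (λ q b<a b<c → q (reflects b<a) (reflects b<c)) p) ∷ noValley-map⁺ ps

  noValley-map⁻ : ∀ {xs} → NoValley _⊏′_ (map f xs) → NoValley _⊏_ xs
  noValley-map⁻ {[]} [] = []
  noValley-map⁻ {x ∷ xs} (p ∷ ps) =
    AllPairs.map (λ q b<a b<c → q (mono b<a) (mono b<c)) (AllPairs.map⁻ p) ∷ noValley-map⁻ ps

allPairs-lookup : ∀ {R : Rel A ℓ} {xs : List A} → AllPairs R xs →
                  ∀ i j → i Fin.< j → R (lookup xs i) (lookup xs j)
allPairs-lookup {xs = _ ∷ xs} (p ∷ ps) Fin.zero    (Fin.suc j) _         = All.lookup p (∈-lookup j)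
allPairs-lookup               (p ∷ ps) (Fin.suc i) (Fin.suc j) (s≤s i<j) = allPairs-lookup ps i j i<j

all-tabulate : ∀ {P : A → Set ℓ} (xs : List A) → (∀ i → P (lookup xs i)) → All P xs
all-tabulate []       p = []
all-tabulate (x ∷ xs) p = p Fin.zero ∷ all-tabulate xs (p ∘ Fin.suc)

allPairs-tabulate : ∀ {R : Rel A ℓ} (xs : List A) →
                    (∀ i j → i Fin.< j → R (lookup xs i) (lookup xs j)) → AllPairs R xs
allPairs-tabulate []       r = []
allPairs-tabulate (x ∷ xs) r =
  all-tabulate xs (λ j → r Fin.zero (Fin.suc j) (s≤s z≤n)) ∷
  allPairs-tabulate xs (λ i j i<j → r (Fin.suc i) (Fin.suc j) (s≤s i<j))

allPairs-++⁻ˡ : ∀ {R : Rel A ℓ} (xs : List A) {ys} → AllPairs R (xs ++ ys) → AllPairs R xs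
allPairs-++⁻ˡ []       _        = []
allPairs-++⁻ˡ (x ∷ xs) (p ∷ ps) = All.++⁻ˡ xs p ∷ allPairs-++⁻ˡ xs ps

allPairs-middle : ∀ {R : Rel A ℓ} (xs : List A) {y z zs} →
                  AllPairs R (xs ++ y ∷ z ∷ zs) → R y z
allPairs-middle []       ((p ∷ _) ∷ _) = p
allPairs-middle (x ∷ xs) (_ ∷ ps)      = allPairs-middle xs ps

module _ {_⊏_ : Rel A ℓ} where

  noValley-lookup : ∀ {xs} → NoValley _⊏_ xs → ∀ i j k → i Fin.< j → j Fin.< k →
                    lookup xs j ⊏ lookup xs i → ¬ (lookup xs j ⊏ lookup xs k)
  noValley-lookup (p ∷ ps) Fin.zero (Fin.suc j) (Fin.suc k) _ (s≤s j<k) = allPairs-lookup p j k j<k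
  noValley-lookup (p ∷ ps) (Fin.suc i) (Fin.suc j) (Fin.suc k) (s≤s i<j) (s≤s j<k) =
    noValley-lookup ps i j k i<j j<k

  noValley-tabulate : ∀ xs → (∀ i j k → i Fin.< j → j Fin.< k →
                      lookup xs j ⊏ lookup xs i → ¬ (lookup xs j ⊏ lookup xs k)) → NoValley _⊏_ xs
  noValley-tabulate []       v = []
  noValley-tabulate (x ∷ xs) v =
    allPairs-tabulate xs (λ j k j<k → v Fin.zero (Fin.suc j) (Fin.suc k) (s≤s z≤n) (s≤s j<k)) ∷
    noValley-tabulate xs (λ i j k i<j j<k → v (Fin.suc i) (Fin.suc j) (Fin.suc k) (s≤s i<j) (s≤s j<k))

  noValley-++⁻ˡ : ∀ xs {ys} → NoValley _⊏_ (xs ++ ys) → NoValley _⊏_ xs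
  noValley-++⁻ˡ []       _        = []
  noValley-++⁻ˡ (x ∷ xs) (p ∷ ps) = allPairs-++⁻ˡ xs p ∷ noValley-++⁻ˡ xs ps

-- Avoiding 213 and 312 means having no valley.

213-312 : List (List ℕ)
213-312 = (2 ∷ 1 ∷ 3 ∷ []) ∷ (3 ∷ 1 ∷ 2 ∷ []) ∷ []

-- Only the comparisons of the outer positions with the middle one are used, and they have the same
-- outcome in both patterns.
noValley⇒avoids : ∀ {π} → NoValley _<_ π → All (π Avoids_) 213-312
noValley⇒avoids {π} v =
  (λ { (i ∷ j ∷ k ∷ [] , ↑ , iso) → dip (↑ 0F 1F (s≤s z≤n)) (↑ 1F 2F (s≤s (s≤s z≤n)))
        (λ p → contradiction (to (iso 0F 1F) p) λ { (s≤s ()) })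
        (λ p → contradiction (to (iso 2F 1F) p) λ { (s≤s ()) }) }) ∷
  (λ { (i ∷ j ∷ k ∷ [] , ↑ , iso) → dip (↑ 0F 1F (s≤s z≤n)) (↑ 1F 2F (s≤s (s≤s z≤n)))
        (λ p → contradiction (to (iso 0F 1F) p) λ { (s≤s ()) })
        (λ p → contradiction (to (iso 2F 1F) p) λ { (s≤s ()) }) }) ∷ []
  where
  open Equivalence
  dip : ∀ {i j k} → i Fin.< j → j Fin.< k →
        ¬ (lookup π i ≤ lookup π j) → ¬ (lookup π k ≤ lookup π j) → ⊥
  dip i<j j<k i≰j k≰j = noValley-lookup v _ _ _ i<j j<k (ℕ.≰⇒> i≰j) (ℕ.≰⇒> k≰j)

module _ (π : List ℕ) {i j k : Fin (length π)} (i<j : i Fin.< j) (j<k : j Fin.< k) where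

  private
    increasing : StrictlyIncreasing (i ∷ j ∷ k ∷ [])
    increasing 0F 1F _ = i<j
    increasing 0F 2F _ = Fin.<-trans i<j j<k
    increasing 1F 2F _ = j<k
    increasing 0F 0F ()
    increasing 1F 0F ()
    increasing 1F 1F (s≤s ())
    increasing 2F 0F ()
    increasing 2F 1F (s≤s ())
    increasing 2F 2F (s≤s (s≤s ()))

    same : ∀ {m p} → (m ≤ m) ⇔ (p ≤ p)
    same = mk⇔ (λ _ → ℕ.≤-refl) (λ _ → ℕ.≤-refl)

    below : ∀ {m m′ p p′} → m < m′ → p < p′ → (m ≤ m′) ⇔ (p ≤ p′)
    below m<m′ p<p′ = mk⇔ (λ _ → ℕ.<⇒≤ p<p′) (λ _ → ℕ.<⇒≤ m<m′)

    above : ∀ {m m′ p p′} → m < m′ → p < p′ → (m′ ≤ m) ⇔ (p′ ≤ p)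
    above m<m′ p<p′ = mk⇔ (λ q → contradiction q (ℕ.<⇒≱ m<m′)) (λ q → contradiction q (ℕ.<⇒≱ p<p′))

    1<2 : 1 < 2
    1<2 = s≤s (s≤s z≤n)
    1<3 : 1 < 3
    1<3 = s≤s (s≤s z≤n)
    2<3 : 2 < 3
    2<3 = s≤s (s≤s (s≤s z≤n))

  contains-213 : lookup π j < lookup π i → lookup π i < lookup π k → π Contains (2 ∷ 1 ∷ 3 ∷ [])
  contains-213 y<x x<z = i ∷ j ∷ k ∷ [] , increasing , λ where
      0F 0F → same
      0F 1F → above y<x 1<2
      0F 2F → below x<z 2<3
      1F 0F → below y<x 1<2
      1F 1F → same
      1F 2F → below y<z 1<3
      2F 0F → above x<z 2<3
      2F 1F → above y<z 1<3
      2F 2F → same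
    where y<z = ℕ.<-trans y<x x<z

  contains-312 : lookup π j < lookup π k → lookup π k < lookup π i → π Contains (3 ∷ 1 ∷ 2 ∷ [])
  contains-312 y<z z<x = i ∷ j ∷ k ∷ [] , increasing , λ where
      0F 0F → same
      0F 1F → above y<x 1<3
      0F 2F → above z<x 2<3
      1F 0F → below y<x 1<3
      1F 1F → same
      1F 2F → below y<z 1<2
      2F 0F → below z<x 2<3
      2F 1F → above y<z 1<2
      2F 2F → same
    where y<x = ℕ.<-trans y<z z<x

-- Comparing the outer entries of a valley tells which of the two patterns it is. Distinctness rules
-- out a tie.
avoids⇒noValley : ∀ {π} → Unique π → All (π Avoids_) 213-312 → NoValley _<_ π
avoids⇒noValley {π} u (¬213 ∷ ¬312 ∷ []) = noValley-tabulate π valley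
  where
  valley : ∀ i j k → i Fin.< j → j Fin.< k → lookup π j < lookup π i → ¬ (lookup π j < lookup π k)
  valley i j k i<j j<k y<x y<z with ℕ.<-cmp (lookup π i) (lookup π k)
  ... | tri< x<z _ _ = ¬213 (contains-213 π i<j j<k y<x x<z)
  ... | tri≈ _ x≡z _ = allPairs-lookup u i k (Fin.<-trans i<j j<k) x≡z
  ... | tri> _ _ z<x = ¬312 (contains-312 π i<j j<k y<z z<x)

-- Enumeration of the unimodal arrangements of an ascending list.

unimodals : A → List A → List (List A)
-- The greatest label has only one place, since front and back of the empty word agree. This keeps
-- the list free of repetitions.
unimodals x []       = (x ∷ []) ∷ []
unimodals x (y ∷ ys) = map (x ∷_) (unimodals y ys) ++ map (_∷ʳ x) (unimodals y ys)

∈-unimodals⇒↭ : ∀ {σ : List A} x ys → σ ∈ unimodals x ys → σ ↭ x ∷ ys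
∈-unimodals⇒↭ x []       (here refl) = ↭-refl
∈-unimodals⇒↭ x (y ∷ ys) σ∈ with ∈-++⁻ (map (x ∷_) (unimodals y ys)) σ∈
... | inj₁ σ∈ with τ , τ∈ , refl ← ∈-map⁻ (x ∷_) σ∈ = prep x (∈-unimodals⇒↭ y ys τ∈)
... | inj₂ σ∈ with τ , τ∈ , refl ← ∈-map⁻ (_∷ʳ x) σ∈ =
  ↭-trans (↭-sym (∷↭∷ʳ x τ)) (prep x (∈-unimodals⇒↭ y ys τ∈))

noDip-min : All (x Fin.<_) σ → NoDip Fin._<_ x σ
noDip-min []         = []
noDip-min (x<b ∷ ps) = All.universal (λ _ b<x → contradiction x<b (ℕ.<-asym b<x)) _ ∷ noDip-min ps

-- At the end, `x` could only be the right-hand side of a valley, and it is too small for that.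
noDip-∷ʳ : All (x Fin.<_) σ → NoDip Fin._<_ y σ → NoDip Fin._<_ y (σ ∷ʳ x)
noDip-∷ʳ x<σ p = AllPairs.++⁺ p ([] ∷ []) (All.map (λ x<b → (λ _ b<x → ℕ.<-asym x<b b<x) ∷ []) x<σ)

noValley-∷ʳ : All (x Fin.<_) σ → NoValley Fin._<_ σ → NoValley Fin._<_ (σ ∷ʳ x)
noValley-∷ʳ []        []       = [] ∷ []
noValley-∷ʳ (_ ∷ x<σ) (p ∷ ps) = noDip-∷ʳ x<σ p ∷ noValley-∷ʳ x<σ ps

∈-unimodals⇒noValley : ∀ x ys → AllPairs Fin._<_ (x ∷ ys) → σ ∈ unimodals x ys → NoValley Fin._<_ σ
∈-unimodals⇒noValley x [] _ (here refl) = [] ∷ []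
∈-unimodals⇒noValley x (y ∷ ys) (x<ys ∷ asc) σ∈ with ∈-++⁻ (map (x ∷_) (unimodals y ys)) σ∈
... | inj₁ σ∈ with τ , τ∈ , refl ← ∈-map⁻ (x ∷_) σ∈ =
  noDip-min (All-resp-↭ (↭-sym (∈-unimodals⇒↭ y ys τ∈)) x<ys) ∷ ∈-unimodals⇒noValley y ys asc τ∈
... | inj₂ σ∈ with τ , τ∈ , refl ← ∈-map⁻ (_∷ʳ x) σ∈ =
  noValley-∷ʳ (All-resp-↭ (↭-sym (∈-unimodals⇒↭ y ys τ∈)) x<ys) (∈-unimodals⇒noValley y ys asc τ∈)

-- The least label cannot stand strictly inside a list without a valley.
∈-unimodals⁺ : ∀ x ys → AllPairs Fin._<_ (x ∷ ys) → σ ↭ x ∷ ys → NoValley Fin._<_ σ → σ ∈ unimodals x ys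
∈-unimodals⁺ x [] _ p v with refl ← ↭-singleton-inv p = here refl
∈-unimodals⁺ x (y ∷ ys) (x<ys ∷ asc) p v with ∈-∃++ (∈-resp-↭ (↭-sym p) (here refl))
∈-unimodals⁺ x (y ∷ ys) (x<ys ∷ asc) p (_ ∷ v) | [] , bs , refl =
  ∈-++⁺ˡ (∈-map⁺ (x ∷_) (∈-unimodals⁺ y ys asc (drop-∷ p) v))
∈-unimodals⁺ x (y ∷ ys) (x<ys ∷ asc) p v | as@(_ ∷ _) , [] , refl =
  ∈-++⁺ʳ (map (x ∷_) (unimodals y ys)) (∈-map⁺ (_∷ʳ x)
    (∈-unimodals⁺ y ys asc (drop-∷ (↭-trans (∷↭∷ʳ x as) p)) (noValley-++⁻ˡ as v)))
∈-unimodals⁺ x (y ∷ ys) (x<ys ∷ asc) p (dip ∷ v) | a ∷ as , c ∷ bs , refl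
  with x<a ∷ x<rest ← All-resp-↭ (↭-sym (drop-∷ (↭-trans (↭-sym (shift x (a ∷ as) (c ∷ bs))) p))) x<ys =
  contradiction (All.head (All.++⁻ʳ as x<rest)) (allPairs-middle as dip x<a)

-- A word in both halves would start and end with `x`. The inner word is nonempty, being a
-- rearrangement of `y ∷ ys`, so `x` would head a word all of whose labels exceed it.
unimodals-unique : ∀ (x : Fin n) ys → AllPairs Fin._<_ (x ∷ ys) → Unique (unimodals x ys)
unimodals-unique x []       _            = [] ∷ []
unimodals-unique x (y ∷ ys) (x<ys ∷ asc) =
  Unique.++⁺ (Unique.map⁺ ∷-injectiveʳ u) (Unique.map⁺ (∷ʳ-injectiveˡ _ _) u) disjoint
  where
  u = unimodals-unique y ys asc
  disjoint : Disjoint (map (x ∷_) (unimodals y ys)) (map (_∷ʳ x) (unimodals y ys))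
  disjoint (∈₁ , ∈₂) with ∈-map⁻ (x ∷_) ∈₁ | ∈-map⁻ (_∷ʳ x) ∈₂
  ... | _ , _ , refl | [] , τ∈ , _ = contradiction (↭-length (∈-unimodals⇒↭ y ys τ∈)) λ ()
  ... | _ , _ , refl | z ∷ τ , τ∈ , refl =
    ℕ.<-irrefl refl (All.head (All-resp-↭ (↭-sym (∈-unimodals⇒↭ y ys τ∈)) x<ys))

linked-∷ʳ : All (x Fin.<_) σ → Linked Fin._>_ σ → Linked Fin._>_ (σ ∷ʳ x)
linked-∷ʳ []            []       = [-]
linked-∷ʳ (x<b ∷ [])    [-]      = x<b ∷ [-]
linked-∷ʳ (_ ∷ x<σ)     (p ∷ ps) = p ∷ linked-∷ʳ x<σ ps

peak-∷ʳ : ∀ {b d} → All (x Fin.<_) σ → Peak b d σ → Peak b (suc d) (σ ∷ʳ x)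
peak-∷ʳ {x = x} x<σ (falls {l = l} p) =
  subst (λ d → Peak 0 d (_ ∷ l ∷ʳ x)) (trans (length-++ l) (ℕ.+-comm (length l) 1)) (falls (linked-∷ʳ x<σ p))
peak-∷ʳ (_ ∷ x<σ) (rises p ps) = rises p (peak-∷ʳ x<σ ps)

peak-∷ : ∀ {b d} → All (x Fin.<_) σ → Peak b d σ → Peak (suc b) d (x ∷ σ)
peak-∷ (x<y ∷ _) p@(falls _)   = rises x<y p
peak-∷ (x<y ∷ _) p@(rises _ _) = rises x<y p

-- The sum of g |X| over the subsets X of a set of r elements.
binomialSum : ℕ → (ℕ → ℕ) → ℕ
binomialSum zero    g = g 0
binomialSum (suc r) g = binomialSum r g + binomialSum r (g ∘ suc)

-- The subset behind `binomialSum` is the set of labels inserted at the back, each of which adds one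
-- fall and so shifts `g` by `suc`. The factor `m` is there because the count of paths is known in
-- closed form only after multiplication by the size.
sum-unimodals : ∀ m (f : List (Fin n) → ℕ) (g : ℕ → ℕ) x ys → AllPairs Fin._<_ (x ∷ ys) →
  (∀ {b d σ} → σ ↭ x ∷ ys → Peak b d σ → m * f σ ≡ g d) →
  m * sum (map f (unimodals x ys)) ≡ binomialSum (length ys) g
sum-unimodals m f g x [] _ eq = trans (cong (m *_) (ℕ.+-identityʳ (f (x ∷ [])))) (eq ↭-refl (falls [-]))
sum-unimodals m f g x (y ∷ ys) (x<ys ∷ asc) eq = begin
  m * sum (map f (map (x ∷_) U ++ map (_∷ʳ x) U))
    ≡⟨ cong (λ l → m * sum l) (trans (map-++ f (map (x ∷_) U) _) (cong₂ _++_ (sym (map-∘ U)) (sym (map-∘ U)))) ⟩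
  m * sum (map (f ∘ (x ∷_)) U ++ map (f ∘ (_∷ʳ x)) U)
    ≡⟨ cong (m *_) (sum-++ (map (f ∘ (x ∷_)) U) _) ⟩
  m * (sum (map (f ∘ (x ∷_)) U) + sum (map (f ∘ (_∷ʳ x)) U))
    ≡⟨ ℕ.*-distribˡ-+ m (sum (map (f ∘ (x ∷_)) U)) _ ⟩
  m * sum (map (f ∘ (x ∷_)) U) + m * sum (map (f ∘ (_∷ʳ x)) U)
    ≡⟨ cong₂ _+_
         (sum-unimodals m (f ∘ (x ∷_)) g y ys asc (λ σ↭ p → eq (prep x σ↭) (peak-∷ (above σ↭) p)))
         (sum-unimodals m (f ∘ (_∷ʳ x)) (g ∘ suc) y ys asc
           (λ {_} {_} {σ} σ↭ p → eq (↭-trans (↭-sym (∷↭∷ʳ x σ)) (prep x σ↭)) (peak-∷ʳ (above σ↭) p))) ⟩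
  binomialSum (suc (length ys)) g ∎
  where
  open ≡-Reasoning
  U = unimodals y ys
  above : ∀ {σ} → σ ↭ y ∷ ys → All (x Fin.<_) σ
  above σ↭ = All-resp-↭ (↭-sym σ↭) x<ys

-- Counting by enumeration

-- Duplicate-free lists with the same members are equal as bags, hence permutations of each other.
-- This trades the filter over all paths for an explicit list.
length-filter : ∀ {a p} {A : Set a} {P : A → Set p} (P? : Decidable P) {xs ys : List A} →
                Unique xs → Unique ys → (∀ {x} → x ∈ ys → x ∈ xs × P x) → (∀ {x} → P x → x ∈ ys) →
                length (filter P? xs) ≡ length ys
length-filter P? {xs} xs! ys! sound complete = ↭-length (∼bag⇒↭ (unique∧set⇒bag (Unique.filter⁺ P? xs!) ys!
  (mk⇔ (λ x∈ → complete (proj₂ (∈-filter⁻ P? {xs = xs} x∈)))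
       (λ x∈ → let x∈xs , px = sound x∈ in ∈-filter⁺ P? x∈xs px))))

length-concatMap : ∀ {a b} {A : Set a} {B : Set b} (f : A → List B) xs →
                   length (concatMap f xs) ≡ sum (map (length ∘ f) xs)
length-concatMap f []       = refl
length-concatMap f (x ∷ xs) = trans (length-++ (f x)) (cong (length (f x) +_) (length-concatMap f xs))

pf≡length : ∀ {n ρs} {ws : List (Path n)} → Unique ws →
            (∀ {w} → w ∈ ws → AvoidingParkingFunction ρs w) →
            (∀ {w} → AvoidingParkingFunction ρs w → w ∈ ws) →
            pf n ρs ≡ length ws
pf≡length {n} {ρs} {ws} ws! sound complete =
  length-filter (avoidingParkingFunction? ρs) (paths-unique n (n + n)) ws!
    (λ w∈ → listed (sound w∈) , sound w∈) complete
  where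
  listed : ∀ {w} → AvoidingParkingFunction ρs w → w ∈ paths n (n + n)
  listed {w} (p , _) = subst (λ l → w ∈ paths n l)
    (trans (length-#N+#E w) (cong₂ _+_ norths easts)) (∈-paths w)
    where open IsParkingFunction p

-- A fictitious east step before the path gives `run` a preceding step to start from and puts no
-- condition on the first label.
linked-E∷ : ∀ {n} {w : Path n} → Linked IncreasingIfNorths w → Linked IncreasingIfNorths (E ∷ w)
linked-E∷ []        = [-]
linked-E∷ i@[-]     = tt ∷ i
linked-E∷ i@(_ ∷ _) = tt ∷ i

-- Weighted sums of binomial coefficients

-- The absorption identity, with top `k + j` to avoid truncated subtraction. After Pascal's rule the
-- two parts are the instances at `k`, `suc j` and at `suc k`, `j`.
absorption : ∀ k j → suc k * ((k + j) C suc k) ≡ j * ((k + j) C k)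
absorption k zero = begin
  suc k * ((k + 0) C suc k) ≡⟨ cong (suc k *_) (k>n⇒nCk≡0 (s≤s (ℕ.≤-reflexive (ℕ.+-identityʳ k)))) ⟩
  suc k * 0                 ≡⟨ ℕ.*-zeroʳ (suc k) ⟩
  0                         ∎
  where open ≡-Reasoning
absorption zero (suc j) = begin
  1 * (suc j C 1)     ≡⟨ ℕ.*-identityˡ _ ⟩
  suc j C 1           ≡⟨ nC1≡n (suc j) ⟩
  suc j               ≡⟨ ℕ.*-identityʳ (suc j) ⟨
  suc j * (suc j C 0) ∎
  where open ≡-Reasoning
absorption (suc k) (suc j) = begin
  suc (suc k) * (suc m C suc (suc k))
    ≡⟨ cong (suc (suc k) *_) (nCk+nC[k+1]≡[n+1]C[k+1] m (suc k)) ⟨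
  suc (suc k) * (m C suc k + m C suc (suc k))
    ≡⟨ ℕ.*-distribˡ-+ (suc (suc k)) (m C suc k) _ ⟩
  suc (suc k) * (m C suc k) + suc (suc k) * (m C suc (suc k))
    ≡⟨ cong (suc (suc k) * (m C suc k) +_)
         (subst (λ m → suc (suc k) * (m C suc (suc k)) ≡ j * (m C suc k)) (sym (ℕ.+-suc k j)) (absorption (suc k) j)) ⟩
  suc (suc k) * (m C suc k) + j * (m C suc k)
    ≡⟨ rearrange k j (m C suc k) ⟩
  suc k * (m C suc k) + suc j * (m C suc k)
    ≡⟨ cong (_+ suc j * (m C suc k)) (absorption k (suc j)) ⟩
  suc j * (m C k) + suc j * (m C suc k)
    ≡⟨ ℕ.*-distribˡ-+ (suc j) (m C k) _ ⟨
  suc j * (m C k + m C suc k)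
    ≡⟨ cong (suc j *_) (nCk+nC[k+1]≡[n+1]C[k+1] m k) ⟩
  suc j * (suc m C suc k) ∎
  where
  open ≡-Reasoning
  m = k + suc j
  rearrange : ∀ k j x → suc (suc k) * x + j * x ≡ suc k * x + suc j * x
  rearrange = solve-∀

-- The numerator of the fraction in the theorem for `n = suc r`, with its truncated subtractions
-- kept so that the two agree by computation.
weight : ℕ → ℕ → ℕ
weight r k = suc k * ((2 * suc r ∸ 2 ∸ k) C (r ∸ k))

-- At `r = d + a` nothing is truncated: the top is `d + (a + a)` and the lower index `a`, which
-- symmetry of the binomials exchanges for `d + a`.
weight-+ : ∀ d a → weight (d + a) d ≡ suc d * ((d + (a + a)) C (d + a))
weight-+ d a = cong (suc d *_) (begin
  (2 * suc r ∸ 2 ∸ d) C (r ∸ d)            ≡⟨ cong₂ _C_ top (ℕ.m+n∸m≡n d a) ⟩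
  (d + (a + a)) C a                        ≡⟨ nCk≡nC[n∸k] (ℕ.≤-trans (ℕ.m≤m+n a a) (ℕ.m≤n+m (a + a) d)) ⟩
  (d + (a + a)) C (d + (a + a) ∸ a)        ≡⟨ cong (λ m → (d + (a + a)) C (m ∸ a)) (ℕ.+-assoc d a a) ⟨
  (d + (a + a)) C (r + a ∸ a)              ≡⟨ cong ((d + (a + a)) C_) (ℕ.m+n∸n≡m r a) ⟩
  (d + (a + a)) C r                        ∎)
  where
  open ≡-Reasoning
  r = d + a
  double : ∀ d a → 2 * suc (d + a) ≡ 2 + (d + (d + (a + a)))
  double = solve-∀
  top : 2 * suc r ∸ 2 ∸ d ≡ d + (a + a)
  top = trans (cong (λ m → m ∸ 2 ∸ d) (double d a)) (ℕ.m+n∸m≡n d _)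

module _ where

  open Sum using (sum-syntax)

  -- Induction on `a` with `d + a` fixed: passing from `d` to `suc d` splits off the term `k = d`.
  -- By Pascal's rule this term must be `size` times the difference of `m C r` and `m C suc r`,
  -- which is `first`.
  ballot-weights : ∀ d a →
    suc (d + a) * (suc (d + (a + a)) C suc (d + a))
      ≡ suc (d + a) * (suc (d + (a + a)) C suc (suc (d + a))) + ∑[ k < suc a ] weight (d + a) (d + toℕ k)
  ballot-weights d zero rewrite ℕ.+-identityʳ d = begin
    suc d * (suc d C suc d)
      ≡⟨ cong (suc d *_) (nCn≡1 (suc d)) ⟩
    suc d * 1
      ≡⟨ cong (suc d *_) (nCn≡1 d) ⟨
    suc d * (d C d)
      ≡⟨ cong (λ m → suc d * (m C m)) (ℕ.+-identityʳ d) ⟨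
    suc d * ((d + 0) C (d + 0))
      ≡⟨ weight-+ d 0 ⟨
    weight (d + 0) d
      ≡⟨ cong (λ m → weight m d) (ℕ.+-identityʳ d) ⟩
    weight d d
      ≡⟨ ℕ.+-identityʳ _ ⟨
    weight d d + 0
      ≡⟨ cong₂ _+_ (trans (cong (suc d *_) (k>n⇒nCk≡0 {suc d} ℕ.≤-refl)) (ℕ.*-zeroʳ (suc d))) refl ⟨
    suc d * (suc d C suc (suc d)) + (weight d d + 0) ∎
    where open ≡-Reasoning
  ballot-weights d (suc a) = begin
    size * (suc (d + (suc a + suc a)) C suc (d + suc a))
      ≡⟨ cong₂ (λ m k → size * (suc m C suc k)) m≡ r≡ ⟩
    size * (suc m C suc r)
      ≡⟨ cong (size *_) (nCk+nC[k+1]≡[n+1]C[k+1] m r) ⟨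
    size * (m C r + m C suc r)
      ≡⟨ ℕ.*-distribˡ-+ size (m C r) _ ⟩
    size * (m C r) + size * (m C suc r)
      ≡⟨ cong₂ _+_ first (trans (cong (λ k → suc k * (m C suc r)) r≡) (ballot-weights (suc d) a)) ⟩
    (weight (d + suc a) d + size * (m C suc r)) + (suc r * (m C suc (suc r)) + ∑[ k < suc a ] weight r (suc d + toℕ k))
      ≡⟨ cong₂ (λ x y → (weight (d + suc a) d + size * (m C suc r)) + (x + y))
           (cong (λ k → suc k * (m C suc (suc r))) r≡)
           (Sum.sum-cong-≗ {suc a} (λ k → cong₂ weight r≡ (ℕ.+-suc d (toℕ k)))) ⟨
    (weight (d + suc a) d + size * (m C suc r)) + (size * (m C suc (suc r)) + rest)
      ≡⟨ rearrange (weight (d + suc a) d) size (m C suc r) (m C suc (suc r)) rest ⟩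
    size * (m C suc r + m C suc (suc r)) + (weight (d + suc a) d + rest)
      ≡⟨ cong₂ (λ x y → size * x + (y + rest)) (nCk+nC[k+1]≡[n+1]C[k+1] m (suc r))
           (cong (weight (d + suc a)) (sym (ℕ.+-identityʳ d))) ⟩
    size * (suc m C suc (suc r)) + ∑[ k < suc (suc a) ] weight (d + suc a) (d + toℕ k)
      ≡⟨ cong₂ (λ m k → size * (suc m C suc (suc k)) + ∑[ k < suc (suc a) ] weight (d + suc a) (d + toℕ k)) m≡ r≡ ⟨
    size * (suc (d + (suc a + suc a)) C suc (suc (d + suc a))) + ∑[ k < suc (suc a) ] weight (d + suc a) (d + toℕ k) ∎
    where
    open ≡-Reasoning
    size : ℕ
    size = suc (d + suc a)
    m = suc (suc (d + (a + a)))
    r = suc (d + a)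
    rest = ∑[ k < suc a ] weight (d + suc a) (d + suc (toℕ k))
    m≡ : d + (suc a + suc a) ≡ m
    m≡ = double d a
      where
      double : ∀ d a → d + (suc a + suc a) ≡ suc (suc (d + (a + a)))
      double = solve-∀
    r≡ : d + suc a ≡ r
    r≡ = ℕ.+-suc d a
    rearrange : ∀ w n x y z → (w + n * x) + (n * y + z) ≡ n * (x + y) + (w + z)
    rearrange = solve-∀
    regroup : ∀ d a x → suc (suc (d + a)) * x ≡ suc d * x + suc a * x
    regroup = solve-∀
    -- The factor `size` splits as `suc d` plus `suc a`. The first part gives the weight, and
    -- absorption turns the second into the multiple of `m C suc r`.
    first : size * (m C r) ≡ weight (d + suc a) d + size * (m C suc r)
    first = begin
      size * (m C r)
        ≡⟨ cong (λ k → suc k * (m C r)) r≡ ⟩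
      suc r * (m C r)
        ≡⟨ regroup d a (m C r) ⟩
      suc d * (m C r) + suc a * (m C r)
        ≡⟨ cong₂ _+_ (cong₂ (λ m k → suc d * (m C k)) m≡ r≡) absorbed ⟨
      suc d * ((d + (suc a + suc a)) C (d + suc a)) + suc r * (m C suc r)
        ≡⟨ cong₂ _+_ (weight-+ d (suc a)) (cong (λ k → suc k * (m C suc r)) r≡) ⟨
      weight (d + suc a) d + size * (m C suc r) ∎
      where
      m≡′ : r + suc a ≡ m
      m≡′ = reassociate d a
        where
        reassociate : ∀ d a → suc (d + a) + suc a ≡ suc (suc (d + (a + a)))
        reassociate = solve-∀
      absorbed : suc r * (m C suc r) ≡ suc a * (m C r)
      absorbed = subst (λ m → suc r * (m C suc r) ≡ suc a * (m C r)) m≡′ (absorption r (suc a))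

  -- The truth value of `d ≤ k`. It extends the sum over `k ≥ d` to a range independent of `d`, so
  -- that the sums over `d` and `k` can be exchanged.
  indicator : ℕ → ℕ → ℕ
  indicator zero    k       = 1
  indicator (suc d) zero    = 0
  indicator (suc d) (suc k) = indicator d k

  sum-indicator : ∀ d m (v : ℕ → ℕ) →
    ∑[ k < d + m ] (indicator d (toℕ k) * v (toℕ k)) ≡ ∑[ k < m ] v (d + toℕ k)
  sum-indicator zero    m v = Sum.sum-cong-≗ {m} (λ k → ℕ.*-identityˡ (v (toℕ k)))
  sum-indicator (suc d) m v = sum-indicator d m (v ∘ suc)

  binomialSum-∑ : ∀ r m (f : ℕ → Fin m → ℕ) (v : Fin m → ℕ) →
    binomialSum r (λ d → ∑[ k < m ] (f d k * v k)) ≡ ∑[ k < m ] (binomialSum r (λ d → f d k) * v k)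
  binomialSum-∑ zero    m f v = refl
  binomialSum-∑ (suc r) m f v = begin
    binomialSum r (λ d → ∑[ k < m ] (f d k * v k)) + binomialSum r (λ d → ∑[ k < m ] (f (suc d) k * v k))
      ≡⟨ cong₂ _+_ (binomialSum-∑ r m f v) (binomialSum-∑ r m (f ∘ suc) v) ⟩
    ∑[ k < m ] (binomialSum r (λ d → f d k) * v k) + ∑[ k < m ] (binomialSum r (λ d → f (suc d) k) * v k)
      ≡⟨ Sum.∑-distrib-+ {m} _ _ ⟨
    ∑[ k < m ] (binomialSum r (λ d → f d k) * v k + binomialSum r (λ d → f (suc d) k) * v k)
      ≡⟨ Sum.sum-cong-≗ {m} (λ k → ℕ.*-distribʳ-+ (v k) (binomialSum r (λ d → f d k)) _) ⟨
    ∑[ k < m ] (binomialSum (suc r) (λ d → f d k) * v k) ∎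
    where open ≡-Reasoning

  binomialSum-zero : ∀ r → binomialSum r (λ _ → 0) ≡ 0
  binomialSum-zero zero    = refl
  binomialSum-zero (suc r) = cong₂ _+_ (binomialSum-zero r) (binomialSum-zero r)

  -- Both sides count the subsets with at most `k` elements of a set of `r`. A new element is either
  -- left out or uses up one unit of `k`, which is Pascal's rule term by term.
  binomialSum-indicator : ∀ r k → binomialSum r (λ d → indicator d k) ≡ ∑[ i < suc k ] (r C toℕ i)
  binomialSum-indicator zero    k = sym (cong suc (Sum.sum-replicate-zero k))
  binomialSum-indicator (suc r) zero = begin
    binomialSum r (λ d → indicator d 0) + binomialSum r (λ _ → 0)
      ≡⟨ cong₂ _+_ (binomialSum-indicator r 0) (binomialSum-zero r) ⟩
    1 ∎
    where open ≡-Reasoning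
  binomialSum-indicator (suc r) (suc k) = begin
    binomialSum r (λ d → indicator d (suc k)) + binomialSum r (λ d → indicator d k)
      ≡⟨ cong₂ _+_ (binomialSum-indicator r (suc k)) (binomialSum-indicator r k) ⟩
    suc (∑[ i < suc k ] (r C suc (toℕ i))) + ∑[ i < suc k ] (r C toℕ i)
      ≡⟨ cong suc (ℕ.+-comm (∑[ i < suc k ] (r C suc (toℕ i))) _) ⟩
    suc (∑[ i < suc k ] (r C toℕ i) + ∑[ i < suc k ] (r C suc (toℕ i)))
      ≡⟨ cong suc (Sum.∑-distrib-+ {suc k} (λ i → r C toℕ i) (λ i → r C suc (toℕ i))) ⟨
    suc (∑[ i < suc k ] (r C toℕ i + r C suc (toℕ i)))
      ≡⟨ cong suc (Sum.sum-cong-≗ {suc k} (λ i → nCk+nC[k+1]≡[n+1]C[k+1] r (toℕ i))) ⟩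
    suc (∑[ i < suc k ] (suc r C suc (toℕ i))) ∎
    where open ≡-Reasoning

  -- The avoiding parking functions of size `suc r`.

  module _ (r : ℕ) where

    private
      size = suc r
      others : List (Fin size)
      others = tabulate Fin.suc

      ascending : AllPairs Fin._<_ (Fin.zero ∷ others)
      ascending = AllPairs.tabulate⁺-< id

    avoiders : List (Path size)
    avoiders = concatMap (completions 0 E) (unimodals Fin.zero others)

    avoiders-unique : Unique avoiders
    avoiders-unique = Unique.concat⁺
      (All.map⁺ (All.universal (completions-unique 0 E) _))
      (AllPairs.map⁺ (AllPairs.map completions# (unimodals-unique Fin.zero others ascending)))
      where
      -- A path determines its label word, so different words share no completion.
      completions# : {σ τ : List (Fin size)} → σ ≢ τ → Disjoint (completions 0 E σ) (completions 0 E τ)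
      completions# σ≢τ (∈σ , ∈τ) =
        σ≢τ (trans (sym (run-labels (∈-completions⁻ 0 E _ ∈σ))) (run-labels (∈-completions⁻ 0 E _ ∈τ)))

    ∈-avoiders⁺ : ∀ {w} → AvoidingParkingFunction 213-312 w → w ∈ avoiders
    ∈-avoiders⁺ {w} (pf , avoids) =
      ∈-concat⁺′
        (∈-completions⁺ (run 0 E w (trans easts (sym norths)) neverBelow (linked-E∷ labelsIncrease)))
        (∈-map⁺ (completions 0 E) (∈-unimodals⁺ Fin.zero others ascending
          (∼bag⇒↭ (unique∧set⇒bag labelsDistinct (Unique.allFin⁺ size)
            (mk⇔ (λ _ → ∈-allFin _) (λ _ → labelsExhaustive _))))
          (noValley-map⁻ s≤s ℕ.≤-pred
            (avoids⇒noValley (Unique.map⁺ (Fin.toℕ-injective ∘ ℕ.suc-injective) labelsDistinct) avoids))))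
      where open IsParkingFunction pf

    ∈-avoiders⁻ : ∀ {w} → w ∈ avoiders → AvoidingParkingFunction 213-312 w
    ∈-avoiders⁻ {w} w∈
      with _ , w∈σ , σ∈ ← ∈-concat⁻′ _ w∈
      with σ , σ∈ , refl ← ∈-map⁻ (completions 0 E) σ∈
      with ρ ← ∈-completions⁻ 0 E σ w∈σ
      -- The listed word becomes `labels w`, so that what is known of it speaks about the path.
      with refl ← run-labels ρ =
      record
        { norths           = norths≡n
        ; easts            = trans (run-#E ρ) norths≡n
        ; neverBelow       = run-neverBelow ρ
        ; labelsDistinct   = Unique-resp-↭ (setoid (Fin size)) (↭⇒↭ₛ (↭-sym σ↭)) (Unique.allFin⁺ size)
        ; labelsExhaustive = λ i → ∈-resp-↭ (↭-sym σ↭) (∈-allFin i)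
        ; labelsIncrease   = Linked.tail (run-linked ρ)
        } ,
      noValley⇒avoids (noValley-map⁺ s≤s ℕ.≤-pred (∈-unimodals⇒noValley Fin.zero others ascending σ∈))
      where
      σ↭ : labels w ↭ allFin size
      σ↭ = ∈-unimodals⇒↭ Fin.zero others σ∈
      norths≡n : #N w ≡ size
      norths≡n = trans (↭-length σ↭) (length-tabulate id)

    pf≡length-avoiders : pf size 213-312 ≡ length avoiders
    pf≡length-avoiders = pf≡length {size} {213-312} {avoiders} avoiders-unique ∈-avoiders⁻ ∈-avoiders⁺

    -- The theorem with its denominator cleared, so that the whole count stays within the natural
    -- numbers.
    pf-weights : size * pf size 213-312 ≡ ∑[ k < size ] ((∑[ i < suc (toℕ k) ] (r C toℕ i)) * weight r (toℕ k))
    pf-weights = begin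
      size * pf size 213-312
        ≡⟨ cong (size *_) (trans pf≡length-avoiders (length-concatMap (completions 0 E) (unimodals Fin.zero others))) ⟩
      size * sum (map (count 0 E) (unimodals Fin.zero others))
        ≡⟨ sum-unimodals size (count 0 E) g Fin.zero others ascending peaks ⟩
      binomialSum (length others) g
        ≡⟨ cong (λ m → binomialSum m g) (length-tabulate {n = r} Fin.suc) ⟩
      binomialSum r g
        ≡⟨ binomialSum-∑ r size (λ d k → indicator d (toℕ k)) (weight r ∘ toℕ) ⟩
      ∑[ k < size ] (binomialSum r (λ d → indicator d (toℕ k)) * weight r (toℕ k))
        ≡⟨ Sum.sum-cong-≗ {size} (λ k → cong (_* weight r (toℕ k)) (binomialSum-indicator r (toℕ k))) ⟩
      ∑[ k < size ] ((∑[ i < suc (toℕ k) ] (r C toℕ i)) * weight r (toℕ k)) ∎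
      where
      open ≡-Reasoning
      g : ℕ → ℕ
      g d = ∑[ k < size ] (indicator d (toℕ k) * weight r (toℕ k))
      peaks : ∀ {a d σ} → σ ↭ Fin.zero ∷ others → Peak a d σ → size * count 0 E σ ≡ g d
      peaks {a} {d} {σ} σ↭ p = weigh r (ℕ.suc-injective (trans (sym (length-peak p))
          (trans (↭-length σ↭) (length-tabulate id))))
        where
        m = suc (d + (a + a))
        -- A fresh `r` lets the equation given by the length of `σ` be matched, while `σ` keeps its
        -- type.
        weigh : ∀ r → d + a ≡ r → suc r * count 0 E σ ≡
                ∑[ k < suc r ] (indicator d (toℕ k) * weight r (toℕ k))
        weigh r refl = trans
          -- `count-peak` and `ballot-weights` carry the same reflected term, which cancels.
          (ℕ.+-cancelˡ-≡ (suc r * (m C suc (suc r))) _ _ (begin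
            suc r * (m C suc (suc r)) + suc r * count 0 E σ
              ≡⟨ trans (ℕ.+-comm _ (suc r * count 0 E σ)) (sym (ℕ.*-distribˡ-+ (suc r) (count 0 E σ) _)) ⟩
            suc r * (count 0 E σ + m C suc (suc r))
              ≡⟨ cong (suc r *_) (count-peak 0 p) ⟩
            suc r * (m C suc r)
              ≡⟨ ballot-weights d a ⟩
            suc r * (m C suc (suc r)) + ∑[ k < suc a ] weight r (d + toℕ k) ∎))
          (trans (sym (sum-indicator d (suc a) (weight r)))
                 (cong (λ l → ∑[ k < l ] (indicator d (toℕ k) * weight r (toℕ k))) (ℕ.+-suc d a)))

-- Rational form of the identity

open import Data.Integer.Base as ℤ using (+_)
import Data.Integer.Properties as ℤ
open import Data.Rational.Base as ℚ using (ℚ; _/_) renaming (_*_ to _*ℚ_)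
import Data.Rational.Properties as ℚ
open import Data.Rational.Properties using (+-0-commutativeMonoid)
import Algebra.Properties.CommutativeMonoid.Sum +-0-commutativeMonoid as ∑ℚ
open ∑ℚ using (sum-syntax)
open import Data.Rational.Unnormalised.Base as ℚᵘ using (mkℚᵘ; *≡*)
import Data.Rational.Unnormalised.Properties as ℚᵘ

-- Since `_/_` reduces to lowest terms, the identity is checked on unnormalised fractions, where it
-- is a cross multiplication.
fraction-+ : ∀ a b d → + a / suc d ℚ.+ + b / suc d ≡ + (a + b) / suc d
fraction-+ a b d = ℚ.toℚᵘ-injective (begin-equality
  ℚ.toℚᵘ (+ a / suc d ℚ.+ + b / suc d)               ≃⟨ ℚ.toℚᵘ-homo-+ (+ a / suc d) (+ b / suc d) ⟩
  ℚ.toℚᵘ (+ a / suc d) ℚᵘ.+ ℚ.toℚᵘ (+ b / suc d)     ≃⟨ ℚᵘ.+-cong (ℚ.toℚᵘ-fromℚᵘ (mkℚᵘ (+ a) d)) (ℚ.toℚᵘ-fromℚᵘ (mkℚᵘ (+ b) d)) ⟩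
  mkℚᵘ (+ a) d ℚᵘ.+ mkℚᵘ (+ b) d                     ≃⟨ *≡* (cross a b (suc d)) ⟩
  mkℚᵘ (+ (a + b)) d                                 ≃⟨ ℚ.toℚᵘ-fromℚᵘ (mkℚᵘ (+ (a + b)) d) ⟨
  ℚ.toℚᵘ (+ (a + b) / suc d)                         ∎)
  where
  open ℚᵘ.≤-Reasoning
  cross : ∀ a b d → (+ a ℤ.* + d ℤ.+ + b ℤ.* + d) ℤ.* + d ≡ + (a + b) ℤ.* + (d * d)
  cross a b d rewrite sym (ℤ.pos-* a d) | sym (ℤ.pos-* b d) | sym (ℤ.pos-* (a * d + b * d) d)
                    | sym (ℤ.pos-* (a + b) (d * d)) = cong +_ (expand a b d)
    where
    expand : ∀ a b d → (a * d + b * d) * d ≡ (a + b) * (d * d)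
    expand = solve-∀

fraction-* : ∀ a b d → (+ a / 1) *ℚ (+ b / suc d) ≡ + (a * b) / suc d
fraction-* a b d = ℚ.toℚᵘ-injective (begin-equality
  ℚ.toℚᵘ ((+ a / 1) *ℚ (+ b / suc d))                ≃⟨ ℚ.toℚᵘ-homo-* (+ a / 1) (+ b / suc d) ⟩
  ℚ.toℚᵘ (+ a / 1) ℚᵘ.* ℚ.toℚᵘ (+ b / suc d)         ≃⟨ ℚᵘ.*-cong (ℚ.toℚᵘ-fromℚᵘ (mkℚᵘ (+ a) 0)) (ℚ.toℚᵘ-fromℚᵘ (mkℚᵘ (+ b) d)) ⟩
  mkℚᵘ (+ a) 0 ℚᵘ.* mkℚᵘ (+ b) d                     ≃⟨ *≡* (cong₂ ℤ._*_ (sym (ℤ.pos-* a b)) (cong +_ (sym (ℕ.+-identityʳ (suc d))))) ⟩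
  mkℚᵘ (+ (a * b)) d                                 ≃⟨ ℚ.toℚᵘ-fromℚᵘ (mkℚᵘ (+ (a * b)) d) ⟨
  ℚ.toℚᵘ (+ (a * b) / suc d)                         ∎)
  where open ℚᵘ.≤-Reasoning

fraction-cancel : ∀ a d → + (suc d * a) / suc d ≡ + a / 1
fraction-cancel a d = ℚ.fromℚᵘ-cong {mkℚᵘ (+ (suc d * a)) d} {mkℚᵘ (+ a) 0} (*≡* (begin
  + (suc d * a) ℤ.* + 1 ≡⟨ ℤ.*-identityʳ (+ (suc d * a)) ⟩
  + (suc d * a)         ≡⟨ cong +_ (ℕ.*-comm (suc d) a) ⟩
  + (a * suc d)         ≡⟨ ℤ.pos-* a (suc d) ⟩
  + a ℤ.* + suc d       ∎))
  where open ≡-Reasoning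

∑-fraction : ∀ m (f : Fin m → ℕ) d → ∑ℚ.sum (λ i → + f i / suc d) ≡ + Sum.sum f / suc d
∑-fraction zero    f d = ℚ.fromℚᵘ-cong {mkℚᵘ (+ 0) 0} {mkℚᵘ (+ 0) d} (*≡* refl)
∑-fraction (suc m) f d =
  trans (cong (+ f Fin.zero / suc d ℚ.+_) (∑-fraction m (f ∘ Fin.suc) d))
        (fraction-+ (f Fin.zero) (Sum.sum (f ∘ Fin.suc)) d)

theorem26 : (n : ℕ) .{{_ : NonZero n}} →
    + pf n ((2 ∷ 1 ∷ 3 ∷ []) ∷ (3 ∷ 1 ∷ 2 ∷ []) ∷ []) / 1
      ≡ ∑[ k < n ] ∑[ i < suc (toℕ k) ]
          ((+ ((n ∸ 1) C toℕ i) / 1)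
            *ℚ (+ (suc (toℕ k) * ((2 * n ∸ 2 ∸ toℕ k) C (n ∸ 1 ∸ toℕ k))) / n))
theorem26 (suc r) = begin
  + pf size 213-312 / 1
    ≡⟨ fraction-cancel (pf size 213-312) r ⟨
  + (size * pf size 213-312) / size
    ≡⟨ cong (λ m → + m / size) (pf-weights r) ⟩
  + Sum.sum {size} (λ k → row (toℕ k)) / size
    ≡⟨ ∑-fraction size (λ k → row (toℕ k)) r ⟨
  ∑ℚ.sum {size} (λ k → + row (toℕ k) / size)
    ≡⟨ ∑ℚ.sum-cong-≗ {size} {λ k → + row (toℕ k) / size} {λ k → ∑ℚ.sum (rowℚ (toℕ k))} (λ k → row≡rowℚ (toℕ k)) ⟩
  ∑ℚ.sum {size} (λ k → ∑ℚ.sum (rowℚ (toℕ k))) ∎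
  where
  open ≡-Reasoning
  size : ℕ
  size = suc r
  row : ℕ → ℕ
  row k = Sum.sum {suc k} (λ i → r C toℕ i) * weight r k
  rowℚ : (k : ℕ) → Fin (suc k) → ℚ
  rowℚ k i = (+ (r C toℕ i) / 1) *ℚ (+ weight r k / size)
  row≡rowℚ : ∀ k → + row k / size ≡ ∑ℚ.sum (rowℚ k)
  row≡rowℚ k = begin
    + row k / size
      -- The weight does not depend on `i` and moves into the inner sum, where the theorem has it.
      ≡⟨ cong (λ m → + m / size) (Sum.*-distribʳ-sum {suc k} (weight r k) (λ i → r C toℕ i)) ⟩
    + Sum.sum {suc k} (λ i → (r C toℕ i) * weight r k) / size
      ≡⟨ ∑-fraction (suc k) (λ i → (r C toℕ i) * weight r k) r ⟨
    ∑ℚ.sum {suc k} (λ i → + ((r C toℕ i) * weight r k) / size)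
      ≡⟨ ∑ℚ.sum-cong-≗ {suc k} {rowℚ k} {λ i → + ((r C toℕ i) * weight r k) / size}
           (λ i → fraction-* (r C toℕ i) (weight r k) r) ⟨
    ∑ℚ.sum (rowℚ k) ∎
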